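{- There is an effective procedure that, given any time warp term $t$, produces positive integers $m,n_1,\dots,n_m$ and a set of basic time warp terms $\{t_{i,j}\mid 1\le i\le m,\ 1\le j\le n_i\}$ such that $\mathbf{W}\models t\approx\bigwedge_{i=1}^m\bigvee_{j=1}^{n_i}t_{i,j}$.
   Context: Let $\overline{\omega}=\omega\cup\{\omega\}$ with its natural order. A time warp is a function $f:\overline{\omega}\to\overline{\omega}$ preserving all suprema; equivalently, a monotone function with $f(0)=0$ and $f(\omega)=\bigvee\{f(n)\mid n\in\omega\}$. Let $W$ be the set of time warps, with composition $fg:=f\circ g$, identity $\mathrm{id}$, pointwise order, pointwise meet $\wedge$ and join $\vee$, least element $\bot$ (constant $0$), greatest element $\top$ ($0\mapsto 0$, $p\mapsto\omega$ for $p\neq0$), and residuals $\backslash,/$ satisfying $f\le h/g\iff fg\le h\iff g\le f\backslash h$. The time warp algebra is $\mathbf{W}=\langle W,\wedge,\vee,\circ,\backslash,/,\mathrm{id},\bot,\top\rangle$. A time warp term is a term over countably many variables in the operation symbols $\wedge,\vee,\circ,\backslash,/,\mathrm{id},\bot,\top$. A time warp term is basic if it is constructed from variables using only $\circ$, $\mathrm{id}$, $\bot$, and the defined unary operations $s^{\ell}:=\mathrm{id}/s$, $s^{r}:=s\backslash\mathrm{id}$ and $s^{o}:=\top\backslash s$. $\mathbf{W}\models s\approx t$ means that $s$ and $t$ evaluate to the same time warp under every assignment of time warps to the variables. -}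

module Defs where

open import Data.Nat as ℕ using (ℕ; zero; suc)
open import Data.Product using (_×_; _,_)
open import Data.List.NonEmpty using (List⁺; _∷_; foldr₁; map)
open import Relation.Binary.PropositionalEquality using (_≡_)

data ω̄ : Set where
  fin : ℕ → ω̄
  ω   : ω̄

infix 4 _≤ω_
data _≤ω_ : ω̄ → ω̄ → Set where
  fin≤fin : ∀ {m n} → m ℕ.≤ n → fin m ≤ω fin n
  _≤ω-top : ∀ p → p ≤ω ω

minω : ω̄ → ω̄ → ω̄
minω (fin m) (fin n) = fin (m ℕ.⊓ n)
minω (fin m) ω       = fin m
minω ω       q       = q

maxω : ω̄ → ω̄ → ω̄
maxω (fin m) (fin n) = fin (m ℕ.⊔ n)
maxω (fin m) ω       = ω
maxω ω       q       = ω

record TimeWarp : Set where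
  field
    fun   : ω̄ → ω̄
    mono  : ∀ {p q} → p ≤ω q → fun p ≤ω fun q
    fun0  : fun (fin 0) ≡ fin 0
    supUB : ∀ n → fun (fin n) ≤ω fun ω
    supLe : ∀ u → (∀ n → fun (fin n) ≤ω u) → fun ω ≤ω u
open TimeWarp public

_≤F_ : (ω̄ → ω̄) → (ω̄ → ω̄) → Set
a ≤F b = ∀ p → a p ≤ω b p

_≤W_ : TimeWarp → TimeWarp → Set
f ≤W g = ∀ p → fun f p ≤ω fun g p

_≐_ : TimeWarp → TimeWarp → Set
f ≐ g = ∀ p → fun f p ≡ fun g p

infixr 6 _∧ₜ_
infixr 5 _∨ₜ_
data Term : Set where
  var  : ℕ → Term
  _∧ₜ_ : Term → Term → Term
  _∨ₜ_ : Term → Term → Term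
  _∘ₜ_ : Term → Term → Term
  _∖ₜ_ : Term → Term → Term
  _/ₜ_ : Term → Term → Term
  idₜ  : Term
  ⊥ₜ   : Term
  ⊤ₜ   : Term

-- Since residuals are defined by a universal property
-- (an infinitary sup/inf, not computable), evaluation is given as a
-- relation: Eval ρ t h  means  "under assignment ρ, term t denotes h".
-- (Classically every term has exactly one value up to ≐.)

Assignment : Set
Assignment = ℕ → TimeWarp

data Eval (ρ : Assignment) : Term → TimeWarp → Set where
  ev-var : ∀ {i h} → h ≐ ρ i → Eval ρ (var i) h
  ev-∧   : ∀ {s t f g h} → Eval ρ s f → Eval ρ t g →
           (∀ p → fun h p ≡ minω (fun f p) (fun g p)) → Eval ρ (s ∧ₜ t) h
  ev-∨   : ∀ {s t f g h} → Eval ρ s f → Eval ρ t g →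
           (∀ p → fun h p ≡ maxω (fun f p) (fun g p)) → Eval ρ (s ∨ₜ t) h
  ev-∘   : ∀ {s t f g h} → Eval ρ s f → Eval ρ t g →
           (∀ p → fun h p ≡ fun f (fun g p)) → Eval ρ (s ∘ₜ t) h
  -- f ∖ g (the paper's f \ g) : the largest k with f ∘ k ≤ g
  ev-∖   : ∀ {s t f g h} → Eval ρ s f → Eval ρ t g →
           (∀ k → (k ≤W h → (λ p → fun f (fun k p)) ≤F fun g)
                × ((λ p → fun f (fun k p)) ≤F fun g → k ≤W h)) →
           Eval ρ (s ∖ₜ t) h
  -- f / g : the largest k with k ∘ g ≤ f
  ev-/   : ∀ {s t f g h} → Eval ρ s f → Eval ρ t g →
           (∀ k → (k ≤W h → (λ p → fun k (fun g p)) ≤F fun f)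
                × ((λ p → fun k (fun g p)) ≤F fun f → k ≤W h)) →
           Eval ρ (s /ₜ t) h
  ev-id  : ∀ {h} → (∀ p → fun h p ≡ p) → Eval ρ idₜ h
  ev-⊥   : ∀ {h} → (∀ p → fun h p ≡ fin 0) → Eval ρ ⊥ₜ h
  ev-⊤   : ∀ {h} → fun h (fin 0) ≡ fin 0 →
           (∀ n → fun h (fin (suc n)) ≡ ω) → fun h ω ≡ ω → Eval ρ ⊤ₜ h

_⊨≈_ : Term → Term → Set
s ⊨≈ t = ∀ (ρ : Assignment) f g → Eval ρ s f → Eval ρ t g → f ≐ g

data BTerm : Set where
  bvar : ℕ → BTerm
  _∘ᵇ_ : BTerm → BTerm → BTerm
  idᵇ  : BTerm
  ⊥ᵇ   : BTerm
  _ˡ   : BTerm → BTerm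
  _ʳ   : BTerm → BTerm
  _ᵒ   : BTerm → BTerm

⌜_⌝ : BTerm → Term
⌜ bvar i ⌝ = var i
⌜ s ∘ᵇ t ⌝ = ⌜ s ⌝ ∘ₜ ⌜ t ⌝
⌜ idᵇ ⌝    = idₜ
⌜ ⊥ᵇ ⌝     = ⊥ₜ
⌜ s ˡ ⌝    = idₜ /ₜ ⌜ s ⌝
⌜ s ʳ ⌝    = ⌜ s ⌝ ∖ₜ idₜ
⌜ s ᵒ ⌝    = ⊤ₜ ∖ₜ ⌜ s ⌝

MeetJoinNF : Set
MeetJoinNF = List⁺ (List⁺ BTerm)

⟦_⟧ⁿᶠ : MeetJoinNF → Term
⟦ nf ⟧ⁿᶠ = foldr₁ _∧ₜ_ (map (λ row → foldr₁ _∨ₜ_ (map ⌜_⌝ row)) nf)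

-- Every operation of W distributes over ∧ and ∨ in each argument. Composition does so on both
-- sides by monotonicity; a residual turns joins into meets in the argument where it is antitone
-- and preserves meets in the other, and since ω̄ is a chain in which infima are attained it also
-- satisfies f \ (g ∨ h) = f\g ∨ f\h, (f ∧ g) \ h = f\h ∨ g\h, (f ∨ g) / h = f/h ∨ g/h and
-- f / (g ∧ h) = f/g ∨ f/h. Pushing every operation down to basic arguments leaves, for basic a
-- and b, a ∘ b, a \ b = a^r b ∨ b^o ∨ (⊤a)^r and a / b = a b^ℓ ∨ (b^ℓ)^o; a lattice term over
-- basic terms is then brought to meet-of-joins form by distributivity. Residuals are computed
-- through (f \ g)(m) = max {q | f q ≤ g m} and (f / g)(m) = min {f p | m ≤ g p} for finite m > 0.

{-# OPTIONS --safe #-}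
module Submission where

open import Defs
open import Algebra.Construct.NaturalChoice.Base using (MinOperator; MaxOperator)
import Algebra.Construct.NaturalChoice.MinMaxOp as MinMaxOp
open import Data.Empty using (⊥; ⊥-elim)
open import Data.List as List using ([]; _∷_)
open import Data.List.NonEmpty using (List⁺; _∷_; _⁺++⁺_; foldr; foldr₁; map)
open import Data.List.NonEmpty.Properties using (map-⁺++⁺)
open import Data.Nat as ℕ using (ℕ; zero; suc; z≤n)
import Data.Nat.Properties as ℕ
open import Data.Product using (Σ; _×_; _,_; proj₁; proj₂)
open import Data.Product.Function.NonDependent.Propositional using (_×-⇔_)
open import Data.Sum using (_⊎_; inj₁; inj₂; [_,_])
open import Data.Sum.Function.Propositional using (_⊎-⇔_)
open import Function using (_∘_)
open import Function.Bundles using (_⇔_; mk⇔; Equivalence)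
import Function.Properties.Equivalence as ⇔
open import Relation.Binary.Bundles using (TotalPreorder)
open import Relation.Binary.PropositionalEquality
  using (_≡_; refl; sym; trans; cong; cong₂; subst; subst₂; isEquivalence)
open import Relation.Nullary using (¬_; Dec; yes; no)
open import Relation.Nullary.Decidable using (decidable-stable)

open Equivalence using (to; from)

-- The chain ω̄

≤ω-refl : ∀ {p} → p ≤ω p
≤ω-refl {fin n} = fin≤fin ℕ.≤-refl
≤ω-refl {ω}     = ω ≤ω-top

≤ω-reflexive : ∀ {p q} → p ≡ q → p ≤ω q
≤ω-reflexive refl = ≤ω-refl

≤ω-trans : ∀ {p q r} → p ≤ω q → q ≤ω r → p ≤ω r
≤ω-trans (fin≤fin a) (fin≤fin b) = fin≤fin (ℕ.≤-trans a b)
≤ω-trans _           (q ≤ω-top)  = _ ≤ω-top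

≤ω-antisym : ∀ {p q} → p ≤ω q → q ≤ω p → p ≡ q
≤ω-antisym (fin≤fin a)  (fin≤fin b)  = cong fin (ℕ.≤-antisym a b)
≤ω-antisym (.ω ≤ω-top) (.ω ≤ω-top) = refl

_≤ω?_ : ∀ p q → Dec (p ≤ω q)
fin m ≤ω? fin n with m ℕ.≤? n
... | yes m≤n = yes (fin≤fin m≤n)
... | no  m≰n = no λ { (fin≤fin m≤n) → m≰n m≤n }
p     ≤ω? ω     = yes (p ≤ω-top)
ω     ≤ω? fin n = no λ ()

≤ω-stable : ∀ {p q} → ¬ ¬ (p ≤ω q) → p ≤ω q
≤ω-stable {p} {q} = decidable-stable (p ≤ω? q)

≰ω⇒≥ω : ∀ {p q} → ¬ (p ≤ω q) → q ≤ω p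
≰ω⇒≥ω {fin m} {fin n} m≰n = fin≤fin (ℕ.<⇒≤ (ℕ.≰⇒> (m≰n ∘ fin≤fin)))
≰ω⇒≥ω {fin m} {ω}     m≰ω = ⊥-elim (m≰ω (_ ≤ω-top))
≰ω⇒≥ω {ω}     {q}     _   = q ≤ω-top

≰ω⇒suc≤ω : ∀ {p n} → ¬ (p ≤ω fin n) → fin (suc n) ≤ω p
≰ω⇒suc≤ω {fin m} m≰n = fin≤fin (ℕ.≰⇒> (m≰n ∘ fin≤fin))
≰ω⇒suc≤ω {ω}     _   = _ ≤ω-top

suc≰ω : ∀ {n} → ¬ (fin (suc n) ≤ω fin n)
suc≰ω (fin≤fin 1+n≤n) = ℕ.<-irrefl refl 1+n≤n

≤ω-total : ∀ p q → p ≤ω q ⊎ q ≤ω p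
≤ω-total p q with p ≤ω? q
... | yes p≤q = inj₁ p≤q
... | no  p≰q = inj₂ (≰ω⇒≥ω p≰q)

0≤ω : ∀ {p} → fin 0 ≤ω p
0≤ω {fin n} = fin≤fin z≤n
0≤ω {ω}     = _ ≤ω-top

≤ω0⇒≡0 : ∀ {p} → p ≤ω fin 0 → p ≡ fin 0
≤ω0⇒≡0 (fin≤fin z≤n) = refl

≤ω-totalPreorder : TotalPreorder _ _ _
≤ω-totalPreorder = record
  { Carrier         = ω̄
  ; _≈_             = _≡_
  ; _≲_             = _≤ω_
  ; isTotalPreorder = record
    { isPreorder = record
      { isEquivalence = isEquivalence
      ; reflexive     = ≤ω-reflexive
      ; trans         = ≤ω-trans
      }
    ; total = ≤ω-total
    }
  }

minω-operator : MinOperator ≤ω-totalPreorder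
minω-operator = record { _⊓_ = minω ; x≤y⇒x⊓y≈x = x≤y⇒min≡x ; x≥y⇒x⊓y≈y = x≥y⇒min≡y }
  where
  x≤y⇒min≡x : ∀ {p q} → p ≤ω q → minω p q ≡ p
  x≤y⇒min≡x (fin≤fin m≤n)      = cong fin (ℕ.m≤n⇒m⊓n≡m m≤n)
  x≤y⇒min≡x {fin m} (_ ≤ω-top) = refl
  x≤y⇒min≡x {ω}     (_ ≤ω-top) = refl
  x≥y⇒min≡y : ∀ {p q} → q ≤ω p → minω p q ≡ q
  x≥y⇒min≡y (fin≤fin n≤m)  = cong fin (ℕ.m≥n⇒m⊓n≡n n≤m)
  x≥y⇒min≡y {ω} (_ ≤ω-top) = refl

maxω-operator : MaxOperator ≤ω-totalPreorder
maxω-operator = record { _⊔_ = maxω ; x≤y⇒x⊔y≈y = x≤y⇒max≡y ; x≥y⇒x⊔y≈x = x≥y⇒max≡x }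
  where
  x≤y⇒max≡y : ∀ {p q} → p ≤ω q → maxω p q ≡ q
  x≤y⇒max≡y (fin≤fin m≤n)      = cong fin (ℕ.m≤n⇒m⊔n≡n m≤n)
  x≤y⇒max≡y {fin m} (_ ≤ω-top) = refl
  x≤y⇒max≡y {ω}     (_ ≤ω-top) = refl
  x≥y⇒max≡x : ∀ {p q} → q ≤ω p → maxω p q ≡ p
  x≥y⇒max≡x (fin≤fin n≤m)  = cong fin (ℕ.m≥n⇒m⊔n≡m n≤m)
  x≥y⇒max≡x {ω} (_ ≤ω-top) = refl

open MinMaxOp minω-operator maxω-operator

≤-minω-⇔ : ∀ {r} p q → r ≤ω minω p q ⇔ (r ≤ω p × r ≤ω q)
≤-minω-⇔ p q = mk⇔ (λ r≤ → x≤y⊓z⇒x≤y p q r≤ , x≤y⊓z⇒x≤z p q r≤) (λ (r≤p , r≤q) → ⊓-glb r≤p r≤q)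

≤-maxω-⇔ : ∀ {r} p q → r ≤ω maxω p q ⇔ (r ≤ω p ⊎ r ≤ω q)
≤-maxω-⇔ {r} p q = mk⇔ split [ x≤y⇒x≤y⊔z q , x≤y⇒x≤z⊔y p ]
  where
  split : r ≤ω maxω p q → r ≤ω p ⊎ r ≤ω q
  split r≤ with ⊔-sel p q
  ... | inj₁ p⊔q≡p = inj₁ (subst (r ≤ω_) p⊔q≡p r≤)
  ... | inj₂ p⊔q≡q = inj₂ (subst (r ≤ω_) p⊔q≡q r≤)

minω-≤-⇔ : ∀ {r} p q → minω p q ≤ω r ⇔ (p ≤ω r ⊎ q ≤ω r)
minω-≤-⇔ {r} p q = mk⇔ split [ x≤y⇒x⊓z≤y q , x≤y⇒z⊓x≤y p ]
  where
  split : minω p q ≤ω r → p ≤ω r ⊎ q ≤ω r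
  split ≤r with ⊓-sel p q
  ... | inj₁ p⊓q≡p = inj₁ (subst (_≤ω r) p⊓q≡p ≤r)
  ... | inj₂ p⊓q≡q = inj₂ (subst (_≤ω r) p⊓q≡q ≤r)

maxω-≤-⇔ : ∀ {r} p q → maxω p q ≤ω r ⇔ (p ≤ω r × q ≤ω r)
maxω-≤-⇔ p q = mk⇔ (λ ≤r → x⊔y≤z⇒x≤z p q ≤r , x⊔y≤z⇒y≤z p q ≤r) (λ (p≤ , q≤) → ⊔-lub p≤ q≤)

≤ω-cong-⇔ : ∀ {p p′ q q′} → p ≡ p′ → q ≡ q′ → p ≤ω q ⇔ p′ ≤ω q′
≤ω-cong-⇔ refl refl = ⇔.refl

infix 4 _IsMaxOf_
_IsMaxOf_ : ω̄ → (ω̄ → Set) → Set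
x IsMaxOf P = ∀ q → q ≤ω x ⇔ P q

IsMaxOf-unique : ∀ {x y P} → x IsMaxOf P → y IsMaxOf P → x ≡ y
IsMaxOf-unique {x} {y} x-max y-max =
  ≤ω-antisym (from (y-max x) (to (x-max x) ≤ω-refl)) (from (x-max y) (to (y-max y) ≤ω-refl))

IsMaxOf-dec : ∀ {x P} → x IsMaxOf P → ∀ q → Dec (P q)
IsMaxOf-dec {x} x-max q with q ≤ω? x
... | yes q≤x = yes (to (x-max q) q≤x)
... | no  q≰x = no (q≰x ∘ from (x-max q))

data Op : Set where
  meet join : Op

dual : Op → Op
dual meet = join
dual join = meet

infix 3.5 _⟨_⟩ˢ_
infix 6 _⟨_⟩ω_ _⟨_⟩ᵂ_

_⟨_⟩ˢ_ : Set → Op → Set → Set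
A ⟨ meet ⟩ˢ B = A × B
A ⟨ join ⟩ˢ B = A ⊎ B

_⟨_⟩ω_ : ω̄ → Op → ω̄ → ω̄
p ⟨ meet ⟩ω q = minω p q
p ⟨ join ⟩ω q = maxω p q

⟨⟩ˢ-cong : ∀ o {A B C D} → A ⇔ B → C ⇔ D → A ⟨ o ⟩ˢ C ⇔ B ⟨ o ⟩ˢ D
⟨⟩ˢ-cong meet = _×-⇔_
⟨⟩ˢ-cong join = _⊎-⇔_

≤-⟨⟩ω-⇔ : ∀ o {r} p q → r ≤ω p ⟨ o ⟩ω q ⇔ r ≤ω p ⟨ o ⟩ˢ r ≤ω q
≤-⟨⟩ω-⇔ meet = ≤-minω-⇔
≤-⟨⟩ω-⇔ join = ≤-maxω-⇔

⟨⟩ω-≤-⇔ : ∀ o {r} p q → p ⟨ o ⟩ω q ≤ω r ⇔ p ≤ω r ⟨ dual o ⟩ˢ q ≤ω r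
⟨⟩ω-≤-⇔ meet = minω-≤-⇔
⟨⟩ω-≤-⇔ join = maxω-≤-⇔

⟨⟩ω-IsMaxOf : ∀ o {x y P Q} → x IsMaxOf P → y IsMaxOf Q → x ⟨ o ⟩ω y IsMaxOf (λ q → P q ⟨ o ⟩ˢ Q q)
⟨⟩ω-IsMaxOf o {x} {y} x-max y-max q = ⇔.trans (≤-⟨⟩ω-⇔ o x y) (⟨⟩ˢ-cong o (x-max q) (y-max q))

⟨⟩ω-mono : ∀ o {p p′ q q′} → p ≤ω p′ → q ≤ω q′ → p ⟨ o ⟩ω q ≤ω p′ ⟨ o ⟩ω q′
⟨⟩ω-mono meet = ⊓-mono-≤
⟨⟩ω-mono join = ⊔-mono-≤

⟨⟩ω-assoc : ∀ o p q r → (p ⟨ o ⟩ω q) ⟨ o ⟩ω r ≡ p ⟨ o ⟩ω (q ⟨ o ⟩ω r)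
⟨⟩ω-assoc meet = ⊓-assoc
⟨⟩ω-assoc join = ⊔-assoc

⟨⟩ω-zero : ∀ o → fin 0 ⟨ o ⟩ω fin 0 ≡ fin 0
⟨⟩ω-zero meet = refl
⟨⟩ω-zero join = refl

-- Time warps

sup-exceeds : ∀ f {u} → ¬ fun f ω ≤ω u → ¬ ¬ Σ ℕ (λ n → ¬ fun f (fin n) ≤ω u)
sup-exceeds f fω≰u no-witness = fω≰u (supLe f _ λ n → ≤ω-stable λ fn≰u → no-witness (n , fn≰u))

⟨⟩ω-supLe : ∀ o f g u → (∀ n → fun f (fin n) ⟨ o ⟩ω fun g (fin n) ≤ω u) → fun f ω ⟨ o ⟩ω fun g ω ≤ω u
⟨⟩ω-supLe join f g u bound = ⊔-lub
  (supLe f u λ n → x⊔y≤z⇒x≤z _ _ (bound n))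
  (supLe g u λ n → x⊔y≤z⇒y≤z _ _ (bound n))
⟨⟩ω-supLe meet f g u bound = ≤ω-stable λ fω⊓gω≰u →
  sup-exceeds f (fω⊓gω≰u ∘ x≤y⇒x⊓z≤y _) λ (m , fm≰u) →
  sup-exceeds g (fω⊓gω≰u ∘ x≤y⇒z⊓x≤y _) λ (n , gn≰u) →
  [ fm≰u ∘ ≤ω-trans (mono f (fin≤fin (ℕ.m≤m⊔n m n)))
  , gn≰u ∘ ≤ω-trans (mono g (fin≤fin (ℕ.m≤n⊔m m n))) ]
  (to (minω-≤-⇔ _ _) (bound (m ℕ.⊔ n)))

_⟨_⟩ᵂ_ : TimeWarp → Op → TimeWarp → TimeWarp
f ⟨ o ⟩ᵂ g = record
  { fun   = λ p → fun f p ⟨ o ⟩ω fun g p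
  ; mono  = λ p≤q → ⟨⟩ω-mono o (mono f p≤q) (mono g p≤q)
  ; fun0  = trans (cong₂ (_⟨ o ⟩ω_) (fun0 f) (fun0 g)) (⟨⟩ω-zero o)
  ; supUB = λ n → ⟨⟩ω-mono o (supUB f n) (supUB g n)
  ; supLe = ⟨⟩ω-supLe o f g
  }

fun-⟨⟩ω : ∀ f o p q → fun f (p ⟨ o ⟩ω q) ≡ fun f p ⟨ o ⟩ω fun f q
fun-⟨⟩ω f meet = mono-≤-distrib-⊓ (cong (fun f)) (mono f)
fun-⟨⟩ω f join = mono-≤-distrib-⊔ (cong (fun f)) (mono f)

≐-fromPositive : ∀ f g → (∀ n → fun f (fin (suc n)) ≡ fun g (fin (suc n))) → f ≐ g
≐-fromPositive f g agree = agree-everywhere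
  where
  agree-finite : ∀ n → fun f (fin n) ≡ fun g (fin n)
  agree-finite zero    = trans (fun0 f) (sym (fun0 g))
  agree-finite (suc n) = agree n
  agree-everywhere : f ≐ g
  agree-everywhere (fin n) = agree-finite n
  agree-everywhere ω       = ≤ω-antisym
    (supLe f (fun g ω) λ n → subst (_≤ω fun g ω) (sym (agree-finite n)) (supUB g n))
    (supLe g (fun f ω) λ n → subst (_≤ω fun f ω) (agree-finite n) (supUB f n))

stepF : ℕ → ω̄ → ω̄ → ω̄
stepF n q p with p ≤ω? fin n
... | yes _ = fin 0
... | no  _ = q

stepF-cases : ∀ n q p → (p ≤ω fin n × stepF n q p ≡ fin 0) ⊎ (fin (suc n) ≤ω p × stepF n q p ≡ q)
stepF-cases n q p with p ≤ω? fin n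
... | yes p≤n = inj₁ (p≤n , refl)
... | no  p≰n = inj₂ (≰ω⇒suc≤ω p≰n , refl)

stepF-high : ∀ n q → stepF n q (fin (suc n)) ≡ q
stepF-high n q with stepF-cases n q (fin (suc n))
... | inj₁ (n+1≤n , _) = ⊥-elim (suc≰ω n+1≤n)
... | inj₂ (_ , ≡q)    = ≡q

-- Testing a universal property against step n q isolates the value at n + 1.
step : ℕ → ω̄ → TimeWarp
step n q = record
  { fun   = stepF n q
  ; mono  = monotone
  ; fun0  = refl
  ; supUB = λ k → bounded (fin k)
  ; supLe = λ u bound → subst (_≤ω u) (stepF-high n q) (bound (suc n))
  }
  where
  bounded : ∀ p → stepF n q p ≤ω q
  bounded p with stepF-cases n q p
  ... | inj₁ (_ , ≡0) = subst (_≤ω q) (sym ≡0) 0≤ω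
  ... | inj₂ (_ , ≡q) = ≤ω-reflexive ≡q
  monotone : ∀ {p p′} → p ≤ω p′ → stepF n q p ≤ω stepF n q p′
  monotone {p} {p′} p≤p′ with stepF-cases n q p | stepF-cases n q p′
  ... | inj₁ (_ , ≡0)    | _                = subst (_≤ω _) (sym ≡0) 0≤ω
  ... | inj₂ (_ , ≡q)    | inj₂ (_ , ≡q′)   = ≤ω-reflexive (trans ≡q (sym ≡q′))
  ... | inj₂ (n<p , _)   | inj₁ (p′≤n , _)  = ⊥-elim (suc≰ω (≤ω-trans n<p (≤ω-trans p≤p′ p′≤n)))

record IsId (i : TimeWarp) : Set where
  constructor isId
  field id-at : ∀ p → fun i p ≡ p
open IsId

record IsTop (T : TimeWarp) : Set where
  constructor isTop
  field top-at : ∀ n → fun T (fin (suc n)) ≡ ω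
open IsTop

IsTop-unique : ∀ {T T′} → IsTop T → IsTop T′ → T ≐ T′
IsTop-unique {T} {T′} top top′ = ≐-fromPositive T T′ λ n → trans (top-at top n) (sym (top-at top′ n))

ω≰fin : ∀ {k} → ¬ ω ≤ω fin k
ω≰fin ()

IsTop-ω : ∀ {T} → IsTop T → ω ≤ω fun T ω
IsTop-ω {T} top = subst (_≤ω fun T ω) (top-at top 0) (supUB T 1)

IsTop-greatest : ∀ {T} → IsTop T → ∀ f p → fun f p ≤ω fun T p
IsTop-greatest top f (fin zero)    = subst (_≤ω _) (sym (fun0 f)) 0≤ω
IsTop-greatest top f (fin (suc n)) = subst (fun f (fin (suc n)) ≤ω_) (sym (top-at top n)) (_ ≤ω-top)
IsTop-greatest top f ω             = ≤ω-trans (_ ≤ω-top) (IsTop-ω top)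

IsTop-below-finite : ∀ {T} → IsTop T → ∀ {p k} → fun T p ≤ω fin k → p ≡ fin 0
IsTop-below-finite top {fin zero}    _    = refl
IsTop-below-finite top {fin (suc n)} Tp≤k = ⊥-elim (ω≰fin (subst (_≤ω _) (top-at top n) Tp≤k))
IsTop-below-finite top {ω}           Tω≤k = ⊥-elim (ω≰fin (≤ω-trans (IsTop-ω top) Tω≤k))

-- Composition and residuals

record IsSingleValued (R : TimeWarp → TimeWarp → TimeWarp → Set) : Set where
  field
    ≐-resp : ∀ {f g h f′ g′ h′} → f ≐ f′ → g ≐ g′ → h ≐ h′ → R f g h → R f′ g′ h′
    unique : ∀ {f g h h′} → R f g h → R f g h′ → h ≐ h′

  ≐-respˡ : ∀ {f g h f′} → f ≐ f′ → R f g h → R f′ g h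
  ≐-respˡ {g = g} {h} f≐f′ = ≐-resp {g′ = g} {h′ = h} f≐f′ (λ _ → refl) (λ _ → refl)

  ≐-respʳ : ∀ {f g h g′} → g ≐ g′ → R f g h → R f g′ h
  ≐-respʳ {f} {h = h} g≐g′ = ≐-resp {f′ = f} {h′ = h} (λ _ → refl) g≐g′ (λ _ → refl)

  ≐-respᵛ : ∀ {f g h h′} → h ≐ h′ → R f g h → R f g h′
  ≐-respᵛ {f} {g} h≐h′ = ≐-resp {f′ = f} {g′ = g} (λ _ → refl) (λ _ → refl) h≐h′

  unique-≐ : ∀ {f g h f′ g′ h′} → R f g h → R f′ g′ h′ → f ≐ f′ → g ≐ g′ → h ≐ h′
  unique-≐ {h = h} R-fgh R-fgh′ f≐f′ g≐g′ = unique (≐-resp {h′ = h} f≐f′ g≐g′ (λ _ → refl) R-fgh) R-fgh′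

record Composite (f g h : TimeWarp) : Set where
  constructor composite
  field
    composite-at : ∀ p → fun h p ≡ fun f (fun g p)

Composite-singleValued : IsSingleValued Composite
Composite-singleValued = record
  { ≐-resp = λ {f} f≐ g≐ h≐ (composite at) → composite λ p →
      trans (sym (h≐ p)) (trans (at p) (trans (cong (fun f) (g≐ p)) (f≐ _)))
  ; unique = λ (composite at) (composite at′) p → trans (at p) (sym (at′ p))
  }

open IsSingleValued Composite-singleValued using ()
  renaming (≐-respʳ to Composite-≐-respʳ; unique-≐ to Composite-unique-≐)

Composite-left : ∀ o {f₁ f₂ g h₁ h₂} → Composite f₁ g h₁ → Composite f₂ g h₂ →
                 Composite (f₁ ⟨ o ⟩ᵂ f₂) g (h₁ ⟨ o ⟩ᵂ h₂)
Composite-left o (composite at₁) (composite at₂) = composite λ p → cong₂ (_⟨ o ⟩ω_) (at₁ p) (at₂ p)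

Composite-right : ∀ o {f g₁ g₂ h₁ h₂} → Composite f g₁ h₁ → Composite f g₂ h₂ →
                  Composite f (g₁ ⟨ o ⟩ᵂ g₂) (h₁ ⟨ o ⟩ᵂ h₂)
Composite-right o {f} (composite at₁) (composite at₂) = composite λ p →
  trans (cong₂ (_⟨ o ⟩ω_) (at₁ p) (at₂ p)) (sym (fun-⟨⟩ω f o _ _))

-- Residuals are pinned down pointwise only at positive finite points; at 0 and ω the
-- time-warp axioms determine them (≐-fromPositive).
record Under (f g h : TimeWarp) : Set where
  constructor under
  field
    under-at : ∀ n → fun h (fin (suc n)) IsMaxOf (λ q → fun f q ≤ω fun g (fin (suc n)))
open Under

LowerBound : (f g : TimeWarp) → ℕ → ω̄ → Set
LowerBound f g n q = ∀ p → fin (suc n) ≤ω fun g p → q ≤ω fun f p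

record Over (f g h : TimeWarp) : Set where
  constructor over
  field
    over-at : ∀ n → fun h (fin (suc n)) IsMaxOf LowerBound f g n

Under-fromUniversal : ∀ f g h →
  (∀ k → (k ≤W h → (λ p → fun f (fun k p)) ≤F fun g) × ((λ p → fun f (fun k p)) ≤F fun g → k ≤W h)) →
  Under f g h
Under-fromUniversal f g h universal = under λ n q → mk⇔
  (λ q≤h → ≤ω-trans (mono f q≤h) (proj₁ (universal h) (λ _ → ≤ω-refl) (fin (suc n))))
  (λ fq≤g → subst (_≤ω _) (stepF-high n q) (proj₂ (universal (step n q)) (f∘step≤g fq≤g) (fin (suc n))))
  where
  f∘step≤g : ∀ {n q} → fun f q ≤ω fun g (fin (suc n)) → ∀ p → fun f (stepF n q p) ≤ω fun g p
  f∘step≤g {n} {q} fq≤g p with stepF-cases n q p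
  ... | inj₁ (_ , ≡0)   = subst (_≤ω fun g p) (sym (trans (cong (fun f) ≡0) (fun0 f))) 0≤ω
  ... | inj₂ (n<p , ≡q) = subst (_≤ω fun g p) (cong (fun f) (sym ≡q)) (≤ω-trans fq≤g (mono g n<p))

Over-fromUniversal : ∀ f g h →
  (∀ k → (k ≤W h → (λ p → fun k (fun g p)) ≤F fun f) × ((λ p → fun k (fun g p)) ≤F fun f → k ≤W h)) →
  Over f g h
Over-fromUniversal f g h universal = over λ n q → mk⇔
  (λ q≤h p n<gp → ≤ω-trans q≤h (≤ω-trans (mono h n<gp) (proj₁ (universal h) (λ _ → ≤ω-refl) p)))
  (λ bound → subst (_≤ω _) (stepF-high n q)
                (proj₂ (universal (step n q)) (step∘g≤f bound) (fin (suc n))))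
  where
  step∘g≤f : ∀ {n q} → LowerBound f g n q → ∀ p → stepF n q (fun g p) ≤ω fun f p
  step∘g≤f {n} {q} bound p with stepF-cases n q (fun g p)
  ... | inj₁ (_ , ≡0)    = subst (_≤ω fun f p) (sym ≡0) 0≤ω
  ... | inj₂ (n<gp , ≡q) = subst (_≤ω fun f p) (sym ≡q) (bound p n<gp)

Under-singleValued : IsSingleValued Under
Under-singleValued = record
  { ≐-resp = λ f≐ g≐ h≐ (under at) → under λ n q →
      ⇔.trans (≤ω-cong-⇔ refl (sym (h≐ _))) (⇔.trans (at n q) (≤ω-cong-⇔ (f≐ q) (g≐ _)))
  ; unique = λ {h = h} {h′} (under at) (under at′) →
      ≐-fromPositive h h′ λ n → IsMaxOf-unique (at n) (at′ n)
  }

Over-singleValued : IsSingleValued Over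
Over-singleValued = record
  { ≐-resp = λ {f} {g} {_} {f′} {g′} f≐ g≐ h≐ (over at) → over λ n q →
      ⇔.trans (≤ω-cong-⇔ refl (sym (h≐ _))) (⇔.trans (at n q) (LowerBound-cong {f} {g} {f′} {g′} f≐ g≐))
  ; unique = λ {h = h} {h′} (over at) (over at′) →
      ≐-fromPositive h h′ λ n → IsMaxOf-unique (at n) (at′ n)
  }
  where
  LowerBound-cong : ∀ {f g f′ g′ n q} → f ≐ f′ → g ≐ g′ → LowerBound f g n q ⇔ LowerBound f′ g′ n q
  LowerBound-cong f≐ g≐ = mk⇔
    (λ bound p n<g′p → subst (_ ≤ω_) (f≐ p) (bound p (subst (_ ≤ω_) (sym (g≐ p)) n<g′p)))
    (λ bound p n<gp → subst (_ ≤ω_) (sym (f≐ p)) (bound p (subst (_ ≤ω_) (g≐ p) n<gp)))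

open IsSingleValued Under-singleValued using ()
  renaming (≐-respʳ to Under-≐-respʳ; unique-≐ to Under-unique-≐)
open IsSingleValued Over-singleValued using () renaming (unique-≐ to Over-unique-≐)

Under-left : ∀ o {f₁ f₂ g h₁ h₂} → Under f₁ g h₁ → Under f₂ g h₂ →
             Under (f₁ ⟨ o ⟩ᵂ f₂) g (h₁ ⟨ dual o ⟩ᵂ h₂)
Under-left o (under at₁) (under at₂) = under λ n q →
  ⇔.trans (⟨⟩ω-IsMaxOf (dual o) (at₁ n) (at₂ n) q) (⇔.sym (⟨⟩ω-≤-⇔ o _ _))

Under-right : ∀ o {f g₁ g₂ h₁ h₂} → Under f g₁ h₁ → Under f g₂ h₂ →
              Under f (g₁ ⟨ o ⟩ᵂ g₂) (h₁ ⟨ o ⟩ᵂ h₂)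
Under-right o (under at₁) (under at₂) = under λ n q →
  ⇔.trans (⟨⟩ω-IsMaxOf o (at₁ n) (at₂ n) q) (⇔.sym (≤-⟨⟩ω-⇔ o _ _))

⊎-byRefutation : ∀ {A B : Set} → Dec A → Dec B → (¬ A → ¬ B → ⊥) → A ⊎ B
⊎-byRefutation (yes a) _       _      = inj₁ a
⊎-byRefutation (no _)  (yes b) _      = inj₂ b
⊎-byRefutation (no ¬a) (no ¬b) refute = ⊥-elim (refute ¬a ¬b)

¬LowerBound⇒witness : ∀ {f g n q} → ¬ LowerBound f g n q →
                      ¬ ¬ Σ ω̄ (λ p → fin (suc n) ≤ω fun g p × ¬ q ≤ω fun f p)
¬LowerBound⇒witness ¬bound no-witness = ¬bound λ p n<gp → ≤ω-stable λ q≰fp → no-witness (p , n<gp , q≰fp)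

Over-left : ∀ o {f₁ f₂ g h₁ h₂} → Over f₁ g h₁ → Over f₂ g h₂ → Over (f₁ ⟨ o ⟩ᵂ f₂) g (h₁ ⟨ o ⟩ᵂ h₂)
Over-left o {f₁} {f₂} {g} (over at₁) (over at₂) = over λ n q →
  ⇔.trans (⟨⟩ω-IsMaxOf o (at₁ n) (at₂ n) q) (combine o (IsMaxOf-dec (at₁ n) q) (IsMaxOf-dec (at₂ n) q))
  where
  combine : ∀ o {n q} → Dec (LowerBound f₁ g n q) → Dec (LowerBound f₂ g n q) →
            LowerBound f₁ g n q ⟨ o ⟩ˢ LowerBound f₂ g n q ⇔ LowerBound (f₁ ⟨ o ⟩ᵂ f₂) g n q
  combine meet _ _ = mk⇔
    (λ (bound₁ , bound₂) p n<gp → ⊓-glb (bound₁ p n<gp) (bound₂ p n<gp))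
    (λ bound → (λ p n<gp → x≤y⊓z⇒x≤y _ _ (bound p n<gp)) , (λ p n<gp → x≤y⊓z⇒x≤z _ _ (bound p n<gp)))
  combine join {n} {q} bound₁? bound₂? = mk⇔
    [ (λ bound₁ p n<gp → x≤y⇒x≤y⊔z _ (bound₁ p n<gp)) , (λ bound₂ p n<gp → x≤y⇒x≤z⊔y _ (bound₂ p n<gp)) ]
    (λ bound → ⊎-byRefutation bound₁? bound₂? (refute bound))
    where
    -- At the smaller of two counterexample points, q fails to be below either fᵢ.
    refute : LowerBound (f₁ ⟨ join ⟩ᵂ f₂) g n q → ¬ LowerBound f₁ g n q → ¬ LowerBound f₂ g n q → ⊥
    refute bound ¬bound₁ ¬bound₂ =
      ¬LowerBound⇒witness {f₁} {g} ¬bound₁ λ (p₁ , n<gp₁ , q≰f₁p₁) →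
      ¬LowerBound⇒witness {f₂} {g} ¬bound₂ λ (p₂ , n<gp₂ , q≰f₂p₂) → case p₁ p₂ n<gp₁ n<gp₂ q≰f₁p₁ q≰f₂p₂
      where
      case : ∀ p₁ p₂ → fin (suc n) ≤ω fun g p₁ → fin (suc n) ≤ω fun g p₂ →
             ¬ q ≤ω fun f₁ p₁ → ¬ q ≤ω fun f₂ p₂ → ⊥
      case p₁ p₂ n<gp₁ n<gp₂ q≰f₁p₁ q≰f₂p₂ with ≤ω-total p₁ p₂
      ... | inj₁ p₁≤p₂ = [ q≰f₁p₁ , q≰f₂p₂ ∘ (λ q≤ → ≤ω-trans q≤ (mono f₂ p₁≤p₂)) ]
                           (to (≤-maxω-⇔ _ _) (bound p₁ n<gp₁))
      ... | inj₂ p₂≤p₁ = [ q≰f₁p₁ ∘ (λ q≤ → ≤ω-trans q≤ (mono f₁ p₂≤p₁)) , q≰f₂p₂ ]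
                           (to (≤-maxω-⇔ _ _) (bound p₂ n<gp₂))

Over-right : ∀ o {f g₁ g₂ h₁ h₂} → Over f g₁ h₁ → Over f g₂ h₂ →
             Over f (g₁ ⟨ o ⟩ᵂ g₂) (h₁ ⟨ dual o ⟩ᵂ h₂)
Over-right o {f} {g₁} {g₂} (over at₁) (over at₂) = over λ n q →
  ⇔.trans (⟨⟩ω-IsMaxOf (dual o) (at₁ n) (at₂ n) q)
          (combine o (IsMaxOf-dec (at₁ n) q) (IsMaxOf-dec (at₂ n) q))
  where
  combine : ∀ o {n q} → Dec (LowerBound f g₁ n q) → Dec (LowerBound f g₂ n q) →
            LowerBound f g₁ n q ⟨ dual o ⟩ˢ LowerBound f g₂ n q ⇔ LowerBound f (g₁ ⟨ o ⟩ᵂ g₂) n q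
  combine join _ _ = mk⇔
    (λ (bound₁ , bound₂) p n<gp → [ bound₁ p , bound₂ p ] (to (≤-maxω-⇔ _ _) n<gp))
    (λ bound → (λ p n<g₁p → bound p (x≤y⇒x≤y⊔z _ n<g₁p)) , (λ p n<g₂p → bound p (x≤y⇒x≤z⊔y _ n<g₂p)))
  combine meet {n} {q} bound₁? bound₂? = mk⇔
    [ (λ bound₁ p n<gp → bound₁ p (x≤y⊓z⇒x≤y _ _ n<gp))
    , (λ bound₂ p n<gp → bound₂ p (x≤y⊓z⇒x≤z _ _ n<gp)) ]
    (λ bound → ⊎-byRefutation bound₁? bound₂? (refute bound))
    where
    -- At the larger of two counterexample points, both gᵢ are above n.
    refute : LowerBound f (g₁ ⟨ meet ⟩ᵂ g₂) n q → ¬ LowerBound f g₁ n q → ¬ LowerBound f g₂ n q → ⊥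
    refute bound ¬bound₁ ¬bound₂ =
      ¬LowerBound⇒witness {f} {g₁} ¬bound₁ λ (p₁ , n<g₁p₁ , q≰fp₁) →
      ¬LowerBound⇒witness {f} {g₂} ¬bound₂ λ (p₂ , n<g₂p₂ , q≰fp₂) → case p₁ p₂ n<g₁p₁ n<g₂p₂ q≰fp₁ q≰fp₂
      where
      case : ∀ p₁ p₂ → fin (suc n) ≤ω fun g₁ p₁ → fin (suc n) ≤ω fun g₂ p₂ →
             ¬ q ≤ω fun f p₁ → ¬ q ≤ω fun f p₂ → ⊥
      case p₁ p₂ n<g₁p₁ n<g₂p₂ q≰fp₁ q≰fp₂ with ≤ω-total p₁ p₂
      ... | inj₁ p₁≤p₂ = q≰fp₂ (bound p₂ (⊓-glb (≤ω-trans n<g₁p₁ (mono g₁ p₁≤p₂)) n<g₂p₂))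
      ... | inj₂ p₂≤p₁ = q≰fp₁ (bound p₁ (⊓-glb n<g₁p₁ (≤ω-trans n<g₂p₂ (mono g₂ p₂≤p₁))))

Under-⊥-isTop : ∀ {z g T} → (∀ p → fun z p ≡ fin 0) → Under z g T → IsTop T
Under-⊥-isTop z≡0 (under at) = isTop λ n →
  ≤ω-antisym (_ ≤ω-top) (from (at n ω) (subst (_≤ω _) (sym (z≡0 ω)) 0≤ω))

Under-id-counit : ∀ {f i r} → IsId i → Under f i r → ∀ {q} p → q ≤ω fun r p → fun f q ≤ω p
Under-id-counit {f} {r = r} _  _          (fin zero)    q≤r0 =
  subst (_≤ω _) (sym (trans (cong (fun f) (≤ω0⇒≡0 (subst (_ ≤ω_) (fun0 r) q≤r0))) (fun0 f))) 0≤ω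
Under-id-counit             id (under at) (fin (suc k)) q≤r  =
  subst (_ ≤ω_) (id-at id _) (to (at k _) q≤r)
Under-id-counit             _  _          ω             _    = _ ≤ω-top

Under-⊤∘-id : ∀ {f i T c s} → IsId i → IsTop T → Composite T f c → Under c i s →
              ∀ n q → q ≤ω fun s (fin (suc n)) ⇔ fun f q ≡ fin 0
Under-⊤∘-id {f} {T = T} id top (composite c-at) (under s-at) n q = mk⇔
  (λ q≤s → IsTop-below-finite top (subst₂ _≤ω_ (c-at q) (id-at id _) (to (s-at n q) q≤s)))
  (λ fq≡0 → from (s-at n q) (subst₂ _≤ω_ (sym (trans (c-at q) (T-at-zero fq≡0))) (sym (id-at id _)) 0≤ω))
  where
  T-at-zero : fun f q ≡ fin 0 → fun T (fun f q) ≡ fin 0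
  T-at-zero fq≡0 = trans (cong (fun T) fq≡0) (fun0 T)

Under-as-join : ∀ {f g h i i′ T T′ r rg o c s} → IsId i → IsId i′ → IsTop T → IsTop T′ →
  Under f i r → Composite r g rg → Under T g o → Composite T′ f c → Under c i′ s →
  (∀ p → fun h p ≡ maxω (fun rg p) (maxω (fun o p) (fun s p))) →
  Under f g h
Under-as-join {f} {g} {r = r} {rg} {o} {s = s}
              id id′ top top′ U-r (composite rg-at) (under o-at) C-c U-s h≡ =
  under λ n q → ⇔.trans (≤ω-cong-⇔ refl (h≡ _))
    (⇔.trans (≤-maxω-⇔ _ _) (⇔.trans (⇔.refl ⊎-⇔ ≤-maxω-⇔ _ _) (mk⇔ (sound n) (complete n))))
  where
  sound : ∀ n {q} → q ≤ω fun rg (fin (suc n)) ⊎ q ≤ω fun o (fin (suc n)) ⊎ q ≤ω fun s (fin (suc n)) →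
          fun f q ≤ω fun g (fin (suc n))
  sound n     (inj₁ q≤rg)        = Under-id-counit id U-r _ (subst (_ ≤ω_) (rg-at _) q≤rg)
  sound n     (inj₂ (inj₁ q≤o)) = ≤ω-trans (IsTop-greatest top f _) (to (o-at n _) q≤o)
  sound n {q} (inj₂ (inj₂ q≤s)) =
    subst (_≤ω _) (sym (to (Under-⊤∘-id id′ top′ C-c U-s n q) q≤s)) 0≤ω
  complete : ∀ n {q} → fun f q ≤ω fun g (fin (suc n)) →
             q ≤ω fun rg (fin (suc n)) ⊎ q ≤ω fun o (fin (suc n)) ⊎ q ≤ω fun s (fin (suc n))
  complete n {q} fq≤g with fun g (fin (suc n)) in g≡
  ... | fin zero    = inj₂ (inj₂ (from (Under-⊤∘-id id′ top′ C-c U-s n q) (≤ω0⇒≡0 fq≤g)))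
  ... | fin (suc k) = inj₁ (subst (_ ≤ω_) (sym (trans (rg-at _) (cong (fun r) g≡)))
                             (from (under-at U-r k q) (subst (_ ≤ω_) (sym (id-at id _)) fq≤g)))
  ... | ω           = inj₂ (inj₁ (from (o-at n q) (subst (_ ≤ω_) (sym g≡) (_ ≤ω-top))))

Over-id-least : ∀ {i g l} → IsId i → Over i g l →
                ∀ {n} p → fin (suc n) ≤ω fun g p → fun l (fin (suc n)) ≤ω p
Over-id-least id (over at) p n<gp = subst (_ ≤ω_) (id-at id p) (to (at _ _) ≤ω-refl p n<gp)

Over-id-attained : ∀ {i g l n k} → IsId i → Over i g l → fun l (fin (suc n)) ≡ fin k →
                   fin (suc n) ≤ω fun g (fin k)
Over-id-attained {g = g} {n = n} id (over at) l≡k = ≤ω-stable λ n≮gk →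
  suc≰ω (subst (_ ≤ω_) l≡k (from (at n _) λ p n<gp →
    subst (_ ≤ω_) (sym (id-at id p)) (≰ω⇒suc≤ω λ p≤k → n≮gk (≤ω-trans n<gp (mono g p≤k)))))

Over-id-empty : ∀ {i g l n} → IsId i → Over i g l → fun l (fin (suc n)) ≡ ω →
                ∀ p → ¬ fin (suc n) ≤ω fun g p
Over-id-empty {g = g} {n = n} id O l≡ω = below-everywhere
  where
  below-finite : ∀ j → ¬ fin (suc n) ≤ω fun g (fin j)
  below-finite j n<gj = ω≰fin (subst (_≤ω _) l≡ω (Over-id-least id O (fin j) n<gj))
  below-everywhere : ∀ p → ¬ fin (suc n) ≤ω fun g p
  below-everywhere (fin j) = below-finite j
  below-everywhere ω n<gω  =
    suc≰ω (≤ω-trans n<gω (supLe g (fin n) λ j → ≤ω-stable λ gj≰n → below-finite j (≰ω⇒suc≤ω gj≰n)))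

Over-as-join : ∀ {f g h i T l fl o} → IsId i → IsTop T →
  Over i g l → Composite f l fl → Under T l o →
  (∀ p → fun h p ≡ maxω (fun fl p) (fun o p)) →
  Over f g h
Over-as-join {f} {g} {l = l} {fl} {o} id top O-l (composite fl-at) (under o-at) h≡ =
  over λ n q → ⇔.trans (≤ω-cong-⇔ refl (h≡ _)) (⇔.trans (≤-maxω-⇔ _ _) (mk⇔ (sound n) (complete n)))
  where
  sound : ∀ n {q} → q ≤ω fun fl (fin (suc n)) ⊎ q ≤ω fun o (fin (suc n)) → LowerBound f g n q
  sound n (inj₁ q≤fl) p n<gp =
    ≤ω-trans (subst (_ ≤ω_) (fl-at _) q≤fl) (mono f (Over-id-least id O-l p n<gp))
  sound n {q} (inj₂ q≤o) p n<gp with fun l (fin (suc n)) in l≡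
  ... | fin k = subst (_≤ω _) (sym q≡0) 0≤ω
    where
    q≡0 : q ≡ fin 0
    q≡0 = IsTop-below-finite top (subst (_ ≤ω_) l≡ (to (o-at n q) q≤o))
  ... | ω     = ⊥-elim (Over-id-empty id O-l l≡ p n<gp)
  complete : ∀ n {q} → LowerBound f g n q → q ≤ω fun fl (fin (suc n)) ⊎ q ≤ω fun o (fin (suc n))
  complete n {q} bound with fun l (fin (suc n)) in l≡
  ... | fin k = inj₁ (subst (_ ≤ω_) (sym (trans (fl-at _) (cong (fun f) l≡)))
                       (bound (fin k) (Over-id-attained id O-l l≡)))
  ... | ω     = inj₂ (from (o-at n q) (subst (_ ≤ω_) (sym l≡) (_ ≤ω-top)))

-- Evaluation

infix 6 _⟨_⟩ₜ_
_⟨_⟩ₜ_ : Term → Op → Term → Term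
s ⟨ meet ⟩ₜ t = s ∧ₜ t
s ⟨ join ⟩ₜ t = s ∨ₜ t

data Splits (R : TimeWarp → TimeWarp → TimeWarp → Set) (ρ : Assignment) (s t : Term) (h : TimeWarp)
            : Set where
  splits : ∀ {f g} → Eval ρ s f → Eval ρ t g → R f g h → Splits R ρ s t h

Eval-⟨⟩ : ∀ o {ρ s t f g} → Eval ρ s f → Eval ρ t g → Eval ρ (s ⟨ o ⟩ₜ t) (f ⟨ o ⟩ᵂ g)
Eval-⟨⟩ meet Es Et = ev-∧ Es Et (λ _ → refl)
Eval-⟨⟩ join Es Et = ev-∨ Es Et (λ _ → refl)

Eval-⟨⟩⁻ : ∀ o {ρ s t h} → Eval ρ (s ⟨ o ⟩ₜ t) h → Splits (λ f g h → h ≐ (f ⟨ o ⟩ᵂ g)) ρ s t h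
Eval-⟨⟩⁻ meet (ev-∧ Es Et h≡) = splits Es Et h≡
Eval-⟨⟩⁻ join (ev-∨ Es Et h≡) = splits Es Et h≡

Eval-∘⁻ : ∀ {ρ s t h} → Eval ρ (s ∘ₜ t) h → Splits Composite ρ s t h
Eval-∘⁻ (ev-∘ Es Et h≡) = splits Es Et (composite h≡)

Eval-∖⁻ : ∀ {ρ s t h} → Eval ρ (s ∖ₜ t) h → Splits Under ρ s t h
Eval-∖⁻ {h = h} (ev-∖ {f = f} {g = g} Es Et universal) =
  splits Es Et (Under-fromUniversal f g h universal)

Eval-/⁻ : ∀ {ρ s t h} → Eval ρ (s /ₜ t) h → Splits Over ρ s t h
Eval-/⁻ {h = h} (ev-/ {f = f} {g = g} Es Et universal) =
  splits Es Et (Over-fromUniversal f g h universal)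

Eval-functional : ∀ {ρ t f g} → Eval ρ t f → Eval ρ t g → f ≐ g
Eval-functional (ev-var f≐) (ev-var g≐) p = trans (f≐ p) (sym (g≐ p))
Eval-functional (ev-∧ Es Et h≡) (ev-∧ Es′ Et′ h≡′) p =
  trans (h≡ p) (trans (cong₂ minω (Eval-functional Es Es′ p) (Eval-functional Et Et′ p)) (sym (h≡′ p)))
Eval-functional (ev-∨ Es Et h≡) (ev-∨ Es′ Et′ h≡′) p =
  trans (h≡ p) (trans (cong₂ maxω (Eval-functional Es Es′ p) (Eval-functional Et Et′ p)) (sym (h≡′ p)))
Eval-functional {f = h} {h′} (ev-∘ {f = f} {g = g} Es Et h≡) (ev-∘ {f = f′} {g = g′} Es′ Et′ h≡′) =
  Composite-unique-≐ (composite {f} {g} {h} h≡) (composite {f′} {g′} {h′} h≡′)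
    (Eval-functional Es Es′) (Eval-functional Et Et′)
Eval-functional {f = h} {h′} (ev-∖ {f = f} {g = g} Es Et universal)
                             (ev-∖ {f = f′} {g = g′} Es′ Et′ universal′) =
  Under-unique-≐ (Under-fromUniversal f g h universal) (Under-fromUniversal f′ g′ h′ universal′)
    (Eval-functional Es Es′) (Eval-functional Et Et′)
Eval-functional {f = h} {h′} (ev-/ {f = f} {g = g} Es Et universal)
                             (ev-/ {f = f′} {g = g′} Es′ Et′ universal′) =
  Over-unique-≐ (Over-fromUniversal f g h universal) (Over-fromUniversal f′ g′ h′ universal′)
    (Eval-functional Es Es′) (Eval-functional Et Et′)
Eval-functional (ev-id f≡) (ev-id g≡) p = trans (f≡ p) (sym (g≡ p))
Eval-functional (ev-⊥ f≡) (ev-⊥ g≡) p = trans (f≡ p) (sym (g≡ p))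
Eval-functional {f = T} {T′} (ev-⊤ _ top _) (ev-⊤ _ top′ _) =
  IsTop-unique {T} {T′} (isTop top) (isTop top′)

-- Lattice terms over basic terms

infix 6 _⟨_⟩_
data LatticeTerm : Set where
  leaf  : BTerm → LatticeTerm
  _⟨_⟩_ : LatticeTerm → Op → LatticeTerm → LatticeTerm

⌜_⌝ᴸ : LatticeTerm → Term
⌜ leaf b ⌝ᴸ    = ⌜ b ⌝
⌜ x ⟨ o ⟩ y ⌝ᴸ = ⌜ x ⌝ᴸ ⟨ o ⟩ₜ ⌜ y ⌝ᴸ

module Distribute
  {R : TimeWarp → TimeWarp → TimeWarp → Set} (single-valued : IsSingleValued R)
  (polˡ polʳ : Op → Op)
  (R-left  : ∀ o {f₁ f₂ g h₁ h₂} → R f₁ g h₁ → R f₂ g h₂ → R (f₁ ⟨ o ⟩ᵂ f₂) g (h₁ ⟨ polˡ o ⟩ᵂ h₂))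
  (R-right : ∀ o {f g₁ g₂ h₁ h₂} → R f g₁ h₁ → R f g₂ h₂ → R f (g₁ ⟨ o ⟩ᵂ g₂) (h₁ ⟨ polʳ o ⟩ᵂ h₂))
  (basic : BTerm → BTerm → LatticeTerm)
  (basic-splits : ∀ {ρ h} a b → Eval ρ ⌜ basic a b ⌝ᴸ h → Splits R ρ ⌜ a ⌝ ⌜ b ⌝ h)
  where
  open IsSingleValued single-valued

  distributeʳ : BTerm → LatticeTerm → LatticeTerm
  distributeʳ a (leaf b)    = basic a b
  distributeʳ a (y ⟨ o ⟩ z) = distributeʳ a y ⟨ polʳ o ⟩ distributeʳ a z

  distribute : LatticeTerm → LatticeTerm → LatticeTerm
  distribute (leaf a)     y = distributeʳ a y
  distribute (x ⟨ o ⟩ x′) y = distribute x y ⟨ polˡ o ⟩ distribute x′ y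

  distributeʳ-splits : ∀ {ρ h} a y → Eval ρ ⌜ distributeʳ a y ⌝ᴸ h → Splits R ρ ⌜ a ⌝ ⌜ y ⌝ᴸ h
  distributeʳ-splits a (leaf b)    E = basic-splits a b E
  distributeʳ-splits a (y ⟨ o ⟩ z) E with Eval-⟨⟩⁻ (polʳ o) E
  ... | splits E₁ E₂ h≐ with distributeʳ-splits a y E₁ | distributeʳ-splits a z E₂
  ...   | splits Ea Ey R₁ | splits Ea′ Ez R₂ =
    splits Ea (Eval-⟨⟩ o Ey Ez)
      (≐-respᵛ (λ p → sym (h≐ p)) (R-right o R₁ (≐-respˡ (Eval-functional Ea′ Ea) R₂)))

  distribute-splits : ∀ {ρ h} x y → Eval ρ ⌜ distribute x y ⌝ᴸ h → Splits R ρ ⌜ x ⌝ᴸ ⌜ y ⌝ᴸ h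
  distribute-splits (leaf a)     y E = distributeʳ-splits a y E
  distribute-splits (x ⟨ o ⟩ x′) y E with Eval-⟨⟩⁻ (polˡ o) E
  ... | splits E₁ E₂ h≐ with distribute-splits x y E₁ | distribute-splits x′ y E₂
  ...   | splits Ex Ey R₁ | splits Ex′ Ey′ R₂ =
    splits (Eval-⟨⟩ o Ex Ex′) Ey
      (≐-respᵛ (λ p → sym (h≐ p)) (R-left o R₁ (≐-respʳ (Eval-functional Ey′ Ey) R₂)))

  distribute-sound : ∀ {ρ f g h k} x y →
                     (∀ {f′} → Eval ρ ⌜ x ⌝ᴸ f′ → f ≐ f′) → (∀ {g′} → Eval ρ ⌜ y ⌝ᴸ g′ → g ≐ g′) →
                     R f g h → Eval ρ ⌜ distribute x y ⌝ᴸ k → h ≐ k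
  distribute-sound x y x-sound y-sound R-fgh E with distribute-splits x y E
  ... | splits Ex Ey R-k = unique-≐ R-fgh R-k (x-sound Ex) (y-sound Ey)

module Composition = Distribute Composite-singleValued (λ o → o) (λ o → o) Composite-left Composite-right
  (λ a b → leaf (a ∘ᵇ b)) (λ _ _ → Eval-∘⁻)

-- The basic terms have no ⊤; ⊥ \ id denotes it (Under-⊥-isTop).
⊤ᵇ : BTerm
⊤ᵇ = ⊥ᵇ ʳ

underBasic : BTerm → BTerm → LatticeTerm
underBasic a b = leaf ((a ʳ) ∘ᵇ b) ⟨ join ⟩ (leaf (b ᵒ) ⟨ join ⟩ leaf ((⊤ᵇ ∘ᵇ a) ʳ))

underBasic-splits : ∀ {ρ h} a b → Eval ρ ⌜ underBasic a b ⌝ᴸ h → Splits Under ρ ⌜ a ⌝ ⌜ b ⌝ h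
underBasic-splits a b (ev-∨ (ev-∘ {f = r} {g = g} {h = rg} E-r Eb rg≡) (ev-∨ E-o E-s os≡) h≡)
  with Eval-∖⁻ E-r | Eval-∖⁻ E-o | Eval-∖⁻ E-s
... | splits Ea (ev-id i≡) U-r | splits (ev-⊤ {h = T} _ top _) Eb′ U-o
    | splits (ev-∘ {f = T′} {g = f′} {h = c} E-⊤ Ea′ c≡) (ev-id i′≡) U-s
  with Eval-∖⁻ E-⊤
... | splits (ev-⊥ z≡) _ U-⊤ =
  splits Ea Eb (Under-as-join (isId i≡) (isId i′≡) (isTop {T} top) (Under-⊥-isTop z≡ U-⊤)
    U-r (composite {r} {g} {rg} rg≡) (Under-≐-respʳ (Eval-functional Eb′ Eb) U-o)
    (Composite-≐-respʳ (Eval-functional Ea′ Ea) (composite {T′} {f′} {c} c≡)) U-s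
    λ p → trans (h≡ p) (cong (maxω _) (os≡ p)))

overBasic : BTerm → BTerm → LatticeTerm
overBasic a b = leaf (a ∘ᵇ (b ˡ)) ⟨ join ⟩ leaf ((b ˡ) ᵒ)

overBasic-splits : ∀ {ρ h} a b → Eval ρ ⌜ overBasic a b ⌝ᴸ h → Splits Over ρ ⌜ a ⌝ ⌜ b ⌝ h
overBasic-splits a b (ev-∨ (ev-∘ {f = f} {g = l} {h = fl} Ea E-l fl≡) E-o h≡)
  with Eval-/⁻ E-l | Eval-∖⁻ E-o
... | splits (ev-id i≡) Eb O-l | splits (ev-⊤ {h = T} _ top _) E-l′ U-o =
  splits Ea Eb (Over-as-join (isId i≡) (isTop {T} top) O-l (composite {f} {l} {fl} fl≡)
    (Under-≐-respʳ (Eval-functional E-l′ E-l) U-o) h≡)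

module UnderResidual = Distribute Under-singleValued dual (λ o → o) Under-left Under-right
  underBasic underBasic-splits
module OverResidual = Distribute Over-singleValued (λ o → o) dual Over-left Over-right
  overBasic overBasic-splits

translate : Term → LatticeTerm
translate (var i)  = leaf (bvar i)
translate (s ∧ₜ t) = translate s ⟨ meet ⟩ translate t
translate (s ∨ₜ t) = translate s ⟨ join ⟩ translate t
translate (s ∘ₜ t) = Composition.distribute (translate s) (translate t)
translate (s ∖ₜ t) = UnderResidual.distribute (translate s) (translate t)
translate (s /ₜ t) = OverResidual.distribute (translate s) (translate t)
translate idₜ      = leaf idᵇ
translate ⊥ₜ       = leaf ⊥ᵇ
translate ⊤ₜ       = leaf ⊤ᵇ

translate-sound : ∀ {ρ t f h} → Eval ρ t f → Eval ρ ⌜ translate t ⌝ᴸ h → f ≐ h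
translate-sound (ev-var f≐) (ev-var h≐) p = trans (f≐ p) (sym (h≐ p))
translate-sound (ev-∧ Es Et f≡) (ev-∧ Es′ Et′ h≡) p =
  trans (f≡ p) (trans (cong₂ minω (translate-sound Es Es′ p) (translate-sound Et Et′ p)) (sym (h≡ p)))
translate-sound (ev-∨ Es Et f≡) (ev-∨ Es′ Et′ h≡) p =
  trans (f≡ p) (trans (cong₂ maxω (translate-sound Es Es′ p) (translate-sound Et Et′ p)) (sym (h≡ p)))
translate-sound {t = s ∘ₜ t} {f} (ev-∘ {f = fs} {g = ft} Es Et f≡) =
  Composition.distribute-sound (translate s) (translate t) (translate-sound Es) (translate-sound Et)
    (composite {fs} {ft} {f} f≡)
translate-sound {t = s ∖ₜ t} {f} (ev-∖ {f = fs} {g = ft} Es Et universal) =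
  UnderResidual.distribute-sound (translate s) (translate t) (translate-sound Es) (translate-sound Et)
    (Under-fromUniversal fs ft f universal)
translate-sound {t = s /ₜ t} {f} (ev-/ {f = fs} {g = ft} Es Et universal) =
  OverResidual.distribute-sound (translate s) (translate t) (translate-sound Es) (translate-sound Et)
    (Over-fromUniversal fs ft f universal)
translate-sound (ev-id f≡) (ev-id h≡) p = trans (f≡ p) (sym (h≡ p))
translate-sound (ev-⊥ f≡) (ev-⊥ h≡) p = trans (f≡ p) (sym (h≡ p))
translate-sound {f = T} {T′} (ev-⊤ _ top _) E-⊤ᵇ with Eval-∖⁻ E-⊤ᵇ
... | splits (ev-⊥ z≡) _ U = IsTop-unique {T} {T′} (isTop top) (Under-⊥-isTop z≡ U)

-- Meet-of-joins normal forms

-- Unlike ⊨≈, which is vacuous for terms without a value, this relation is transitive.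
infix 4 _⇝_
_⇝_ : Term → Term → Set
t ⇝ s = ∀ {ρ g} → Eval ρ t g → Σ TimeWarp λ h → Eval ρ s h × g ≐ h

⇝-refl : ∀ {t} → t ⇝ t
⇝-refl Et = _ , Et , λ _ → refl

⇝-trans : ∀ {t u s} → t ⇝ u → u ⇝ s → t ⇝ s
⇝-trans t⇝u u⇝s Et with t⇝u Et
... | h , Eu , g≐h with u⇝s Eu
...   | k , Es , h≐k = k , Es , λ p → trans (g≐h p) (h≐k p)

⇝-⟨⟩ : ∀ o {t t′ s s′} → t ⇝ s → t′ ⇝ s′ → t ⟨ o ⟩ₜ t′ ⇝ s ⟨ o ⟩ₜ s′
⇝-⟨⟩ o t⇝s t′⇝s′ E with Eval-⟨⟩⁻ o E
... | splits Et Et′ g≐ with t⇝s Et | t′⇝s′ Et′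
...   | h , Es , ≐h | h′ , Es′ , ≐h′ =
  _ , Eval-⟨⟩ o Es Es′ , λ p → trans (g≐ p) (cong₂ (_⟨ o ⟩ω_) (≐h p) (≐h′ p))

⟨⟩ₜ-assoc : ∀ o {s t u} → s ⟨ o ⟩ₜ (t ⟨ o ⟩ₜ u) ⇝ (s ⟨ o ⟩ₜ t) ⟨ o ⟩ₜ u
⟨⟩ₜ-assoc o E with Eval-⟨⟩⁻ o E
... | splits {f} Es Etu g≐ with Eval-⟨⟩⁻ o Etu
...   | splits Et Eu h≐ = _ , Eval-⟨⟩ o (Eval-⟨⟩ o Es Et) Eu ,
  λ p → trans (g≐ p) (trans (cong (fun f p ⟨ o ⟩ω_) (h≐ p)) (sym (⟨⟩ω-assoc o _ _ _)))

∨ₜ-distribˡ-∧ₜ : ∀ {s t u} → (s ∨ₜ t) ∧ₜ (s ∨ₜ u) ⇝ s ∨ₜ (t ∧ₜ u)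
∨ₜ-distribˡ-∧ₜ (ev-∧ (ev-∨ Es Et h₁≡) (ev-∨ Es′ Eu h₂≡) g≡) =
  _ , Eval-⟨⟩ join Es (Eval-⟨⟩ meet Et Eu) ,
  λ p → trans (g≡ p)
    (trans (cong₂ minω (h₁≡ p) (trans (h₂≡ p) (cong (λ x → maxω x _) (Eval-functional Es′ Es p))))
           (sym (⊔-distribˡ-⊓ _ _ _)))

∨ₜ-distribʳ-∧ₜ : ∀ {s t u} → (s ∨ₜ u) ∧ₜ (t ∨ₜ u) ⇝ (s ∧ₜ t) ∨ₜ u
∨ₜ-distribʳ-∧ₜ (ev-∧ (ev-∨ {f = fs} {g = fu} Es Eu h₁≡) (ev-∨ {f = ft} Et Eu′ h₂≡) g≡) =
  _ , Eval-⟨⟩ join (Eval-⟨⟩ meet Es Et) Eu ,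
  λ p → trans (g≡ p)
    (trans (cong₂ minω (h₁≡ p) (trans (h₂≡ p) (cong (maxω _) (Eval-functional Eu′ Eu p))))
           (sym (⊔-distribʳ-⊓ (fun fu p) (fun fs p) (fun ft p))))

-- Stated for an explicit head and tail so that the induction runs over the tail list.
foldr₁-⁺++⁺ : ∀ o x xs (ys : List⁺ Term) →
              foldr₁ (_⟨ o ⟩ₜ_) ((x ∷ xs) ⁺++⁺ ys)
                ⇝ foldr₁ (_⟨ o ⟩ₜ_) (x ∷ xs) ⟨ o ⟩ₜ foldr₁ (_⟨ o ⟩ₜ_) ys
foldr₁-⁺++⁺ o x []        (y ∷ ys) = ⇝-refl
foldr₁-⁺++⁺ o x (x′ ∷ xs) ys       = ⇝-trans (⇝-⟨⟩ o ⇝-refl (foldr₁-⁺++⁺ o x′ xs ys)) (⟨⟩ₜ-assoc o)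

row : List⁺ BTerm → Term
row r = foldr₁ _∨ₜ_ (map ⌜_⌝ r)

row-⁺++⁺ : ∀ r r′ → row (r ⁺++⁺ r′) ⇝ row r ∨ₜ row r′
row-⁺++⁺ r@(b ∷ bs) r′ = subst (λ cs → foldr₁ _∨ₜ_ cs ⇝ row r ∨ₜ row r′) (sym (map-⁺++⁺ ⌜_⌝ r r′))
  (foldr₁-⁺++⁺ join ⌜ b ⌝ (List.map ⌜_⌝ bs) (map ⌜_⌝ r′))

⟦⟧ⁿᶠ-⁺++⁺ : ∀ X Y → ⟦ X ⁺++⁺ Y ⟧ⁿᶠ ⇝ ⟦ X ⟧ⁿᶠ ∧ₜ ⟦ Y ⟧ⁿᶠ
⟦⟧ⁿᶠ-⁺++⁺ X@(r ∷ rs) Y = subst (λ ts → foldr₁ _∧ₜ_ ts ⇝ ⟦ X ⟧ⁿᶠ ∧ₜ ⟦ Y ⟧ⁿᶠ) (sym (map-⁺++⁺ row X Y))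
  (foldr₁-⁺++⁺ meet (row r) (List.map row rs) (map row Y))

⟦⟧ⁿᶠ-map-⁺++⁺ : ∀ r y ys → ⟦ map (r ⁺++⁺_) (y ∷ ys) ⟧ⁿᶠ ⇝ row r ∨ₜ ⟦ y ∷ ys ⟧ⁿᶠ
⟦⟧ⁿᶠ-map-⁺++⁺ r y []        = row-⁺++⁺ r y
⟦⟧ⁿᶠ-map-⁺++⁺ r y (y′ ∷ ys) =
  ⇝-trans (⇝-⟨⟩ meet (row-⁺++⁺ r y) (⟦⟧ⁿᶠ-map-⁺++⁺ r y′ ys)) ∨ₜ-distribˡ-∧ₜ

infixr 5 _∨ⁿᶠ_
_∨ⁿᶠ_ : MeetJoinNF → MeetJoinNF → MeetJoinNF
X ∨ⁿᶠ Y = foldr (λ r Z → map (r ⁺++⁺_) Y ⁺++⁺ Z) (λ r → map (r ⁺++⁺_) Y) X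

⟦⟧ⁿᶠ-∨ⁿᶠ : ∀ r rs Y → ⟦ (r ∷ rs) ∨ⁿᶠ Y ⟧ⁿᶠ ⇝ ⟦ r ∷ rs ⟧ⁿᶠ ∨ₜ ⟦ Y ⟧ⁿᶠ
⟦⟧ⁿᶠ-∨ⁿᶠ r []        (y ∷ ys) = ⟦⟧ⁿᶠ-map-⁺++⁺ r y ys
⟦⟧ⁿᶠ-∨ⁿᶠ r (r′ ∷ rs) Y@(y ∷ ys) =
  ⇝-trans (⟦⟧ⁿᶠ-⁺++⁺ (map (r ⁺++⁺_) Y) ((r′ ∷ rs) ∨ⁿᶠ Y))
    (⇝-trans (⇝-⟨⟩ meet (⟦⟧ⁿᶠ-map-⁺++⁺ r y ys) (⟦⟧ⁿᶠ-∨ⁿᶠ r′ rs Y)) ∨ₜ-distribʳ-∧ₜ)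

normalise : LatticeTerm → MeetJoinNF
normalise (leaf b)       = (b ∷ []) ∷ []
normalise (x ⟨ meet ⟩ y) = normalise x ⁺++⁺ normalise y
normalise (x ⟨ join ⟩ y) = normalise x ∨ⁿᶠ normalise y

normalise-⇝ : ∀ x → ⟦ normalise x ⟧ⁿᶠ ⇝ ⌜ x ⌝ᴸ
normalise-⇝ (leaf b)       = ⇝-refl
normalise-⇝ (x ⟨ meet ⟩ y) =
  ⇝-trans (⟦⟧ⁿᶠ-⁺++⁺ (normalise x) (normalise y)) (⇝-⟨⟩ meet (normalise-⇝ x) (normalise-⇝ y))
normalise-⇝ (x ⟨ join ⟩ y) =
  ⇝-trans (⟦⟧ⁿᶠ-∨ⁿᶠ (List⁺.head (normalise x)) (List⁺.tail (normalise x)) (normalise y))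
          (⇝-⟨⟩ join (normalise-⇝ x) (normalise-⇝ y))

theorem2p8 : Σ (Term → MeetJoinNF) (λ nf → ∀ (t : Term) → t ⊨≈ ⟦ nf t ⟧ⁿᶠ)
theorem2p8 = normalise ∘ translate , λ t ρ f g Et Eg →
  let h , Eh , g≐h = normalise-⇝ (translate t) Eg
  in λ p → trans (translate-sound Et Eh p) (sym (g≐h p))
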